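{- For every $k \in \mathbb{N}$ there exists a strongly $k$-connected digraph $D_k$ which contains no two arc-disjoint directed cycles (and hence no two vertex-disjoint directed cycles) of equal length.
   Context: $\mathbb{N}$ denotes the positive integers. Digraphs are finite, have no loops and no parallel arcs, but may contain anti-parallel pairs of arcs (digons, which count as directed cycles of length $2$). A digraph $D$ is strongly connected if for every ordered pair $(x,y)$ of vertices there is a directed path from $x$ to $y$. For an integer $k\ge 1$, $D$ is strongly $k$-connected if $|V(D)| \ge k+1$ and for every set $S\subseteq V(D)$ of at most $k-1$ vertices, the digraph $D-S$ is strongly connected. The length of a directed cycle is its number of arcs. -}

module Defs where

open import Data.Fin.Base using (Fin)
open import Data.Fin.Subset using (Subset; ∣_∣; _∉_)
open import Data.List.Base using (List; []; _∷_; length)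
open import Data.List.Relation.Binary.Disjoint.Propositional using (Disjoint)
open import Data.List.Relation.Unary.Unique.Propositional using (Unique)
open import Data.Nat.Base using (ℕ; _+_; _<_; _≤_)
open import Data.Product.Base using (_×_; _,_)
open import Data.Refinement.Base using (Refinement-syntax; value)
open import Function.Base using (_on_)
open import Level using (0ℓ)
open import Relation.Binary.Construct.Closure.ReflexiveTransitive using (Star; ε; _◅_)
open import Relation.Binary.Core using (Rel)
open import Relation.Binary.Definitions using (Decidable; Irreflexive)
open import Relation.Binary.PropositionalEquality.Core using (_≡_)

-- The relation is proof-relevant, but an arc is identified with the ordered
-- pair of its ends, so there are no parallel arcs.
record Digraph : Set₁ where
  infix 4 _⟶_
  field
    order  : ℕ
    _⟶_    : Rel (Fin order) 0ℓ
    _⟶?_   : Decidable _⟶_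
    noLoop : Irreflexive _≡_ _⟶_

  Vertex : Set
  Vertex = Fin order

-- Stated for an arbitrary arc relation, so as to apply both to a digraph and
-- to what is left of it after deleting vertices.
module Directed {V : Set} (_⟶_ : Rel V 0ℓ) where

  Walk : Rel V 0ℓ
  Walk = Star _⟶_

  walkVertices : ∀ {x y} → Walk x y → List V
  walkVertices {x} ε       = x ∷ []
  walkVertices {x} (_ ◅ w) = x ∷ walkVertices w

  walkArcs : ∀ {x y} → Walk x y → List (V × V)
  walkArcs ε                 = []
  walkArcs (_◅_ {x} {y} _ w) = (x , y) ∷ walkArcs w

  record Path (x y : V) : Set where
    field
      walk     : Walk x y
      distinct : Unique (walkVertices walk)

  StronglyConnected : Set
  StronglyConnected = ∀ x y → Path x y

  -- A directed path together with an arc from its last vertex back to its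
  -- first.  The path may consist of a single vertex, in which case the closing
  -- arc would be a loop; in a digraph this cannot happen.
  record Cycle : Set where
    field
      {start end} : V
      path        : Path start end
      closing     : end ⟶ start

    vertices : List V
    vertices = walkVertices (Path.walk path)

    arcs : List (V × V)
    arcs = (end , start) ∷ walkArcs (Path.walk path)

  cycleLength : Cycle → ℕ
  cycleLength C = length (Cycle.arcs C)

  ArcDisjoint : Rel Cycle 0ℓ
  ArcDisjoint C C′ = Disjoint (Cycle.arcs C) (Cycle.arcs C′)

  VertexDisjoint : Rel Cycle 0ℓ
  VertexDisjoint C C′ = Disjoint (Cycle.vertices C) (Cycle.vertices C′)

module _ (D : Digraph) where
  open Digraph D

  -- The arc relation of the digraph D − S.  The refinement type makes
  -- membership proofs irrelevant, so equality of remaining vertices is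
  -- equality in D.
  Deleted : (S : Subset order) → Rel [ v ∈ Vertex ∣ v ∉ S ] 0ℓ
  Deleted S = _⟶_ on value

  -- Meant for k ≥ 1, where ∣ S ∣ < k says that S has at most k − 1 elements.
  StronglyKConnected : ℕ → Set
  StronglyKConnected k =
    k + 1 ≤ order ×
    (∀ (S : Subset order) → ∣ S ∣ < k → Directed.StronglyConnected (Deleted S))

  open Directed _⟶_ public
    using (Cycle; cycleLength; ArcDisjoint; VertexDisjoint)

{-# OPTIONS --safe #-}

-- Arrange the vertices in layers of k vertices each, with all arcs from every
-- layer to the next one, and add N back arcs, the i-th of which closes a
-- segment of 2 ^ N + 2 ^ i layers.  The length of a directed cycle is then the
-- sum of the numbers 2 ^ N + 2 ^ i over the back arcs i that it uses, and such
-- a sum determines the set of its summands.  Hence two cycles of equal length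
-- use the same back arcs, and every cycle uses at least one.
--
-- Deleting fewer than k vertices leaves a vertex in each layer, so that every
-- lower layer still reaches every higher one.  Each of the k vertices of the
-- top layer is the source of k back arcs with distinct targets, all below the
-- middle; each of the k vertices of the bottom layer is the target of k back
-- arcs with distinct sources, none below the middle.  So some path from any
-- remaining top vertex to any remaining bottom vertex survives, too.
module Submission where

open import Defs
open import Data.Fin.Base
  using (Fin; zero; suc; toℕ; fromℕ<; combine; quotient; remainder)
open import Data.Fin.Properties
  using (_≟_; any?; ¬∀⟶∃¬; toℕ<n; toℕ-fromℕ<; toℕ-injective; remQuot-combine; combine-remQuot;
         combine-injectiveʳ; suc-injective; *↔×; +↔⊎)
open import Data.Fin.Subset using (Subset; ∣_∣; _∈_; _∉_; _-_)
open import Data.Fin.Subset.Properties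
  using (_∈?_; x∈p⇒∣p-x∣<∣p∣; x∈p∧x≢y⇒x∈p-y)
open import Data.Irrelevant using ([_])
open import Data.List.Base using (List; []; _∷_; _++_; length; map)
open import Data.List.Membership.Propositional using () renaming (_∈_ to _∈ₗ_)
open import Data.List.Membership.Propositional.Properties
  using (∈-map⁺; ∈-++⁺ˡ; ∈-++⁺ʳ)
import Data.List.Membership.DecPropositional as DecMembership
open import Data.List.Relation.Binary.Permutation.Propositional
  using (↭⇒↭ₛ)
open import Data.List.Relation.Binary.Permutation.Propositional.Properties
  using (++-comm)
import Data.List.Relation.Binary.Permutation.Setoid.Properties as Permutation
open import Data.List.Relation.Unary.All as All using ()
open import Data.List.Relation.Unary.All.Properties using (¬Any⇒All¬)
open import Data.List.Relation.Unary.AllPairs using ([]; _∷_)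
open import Data.List.Relation.Unary.Any using (here; there)
open import Data.List.Relation.Unary.Unique.Propositional using (Unique)
import Data.Refinement.Properties as Refinement
open import Data.Refinement.Base using (Refinement-syntax; value; _,_)
open import Data.Nat.Base
  using (ℕ; zero; suc; pred; _+_; _*_; _∸_; _^_; _≤_; _<_; z≤n; s≤s; z<s; s<s; NonZero)
open import Data.Nat.Properties hiding (suc-injective) renaming (_≟_ to _≟ℕ_)
open import Data.Nat.Solver using (module +-*-Solver)
open import Data.Product.Base using (Σ-syntax; ∃-syntax; _×_; _,_; proj₁; proj₂)
open import Data.Sum.Base using (_⊎_; inj₁; inj₂)
open import Data.Sum.Function.Propositional using (_⊎-↔_)
open import Data.Vec.Functional using (Vector; updateAt)
open import Data.Vec.Functional.Properties using (updateAt-updates; updateAt-minimal)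
open import Function.Base using (_∘_)
open import Function.Bundles using (_↔_; module Inverse)
open import Function.Construct.Composition using (_↔-∘_)
open import Function.Definitions using (Injective)
open import Level using (0ℓ)
open import Relation.Binary.Construct.Closure.ReflexiveTransitive
  using (ε; _◅_; _◅◅_)
open import Relation.Binary.Core using (Rel)
open import Relation.Binary.Definitions using (Decidable; DecidableEquality; Irreflexive)
open import Relation.Binary.PropositionalEquality
open import Relation.Nullary.Decidable using (yes; no; map′; _×-dec_; _⊎-dec_)
open import Relation.Nullary.Negation.Core using (¬_; contradiction)

-- Walks, paths and cycles in an arbitrary digraph.

module _ {V : Set} {_⟶_ : Rel V 0ℓ} where
  private module G = Directed _⟶_
  open G using (Walk; Path; walkVertices; walkArcs)

  arcSources : ∀ {x y} → Walk x y → List V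
  arcSources w = map proj₁ (walkArcs w)

  walkVertices-sources : ∀ {x y} (w : Walk x y) → walkVertices w ≡ arcSources w ++ y ∷ []
  walkVertices-sources ε       = refl
  walkVertices-sources (_ ◅ w) = cong (_ ∷_) (walkVertices-sources w)

  module _ (C : G.Cycle) where
    open G.Cycle C

    closedWalk : Walk end end
    closedWalk = closing ◅ Path.walk path

    -- These sources are the vertices of the path with the last one moved to the front, hence a
    -- permutation of a duplicate-free list.
    closedWalk-sources-unique : Unique (arcSources closedWalk)
    closedWalk-sources-unique =
      Permutation.Unique-resp-↭ (setoid V)
        (↭⇒↭ₛ (++-comm (arcSources (Path.walk path)) (end ∷ [])))
        (subst Unique (walkVertices-sources (Path.walk path)) (Path.distinct path))

    -- Cycles sharing an arc thus share its source, so vertex-disjoint cycles are arc-disjoint.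
    arc-source∈vertices : ∀ {a} → a ∈ₗ arcs → proj₁ a ∈ₗ vertices
    arc-source∈vertices {a} a∈ =
      subst (proj₁ a ∈ₗ_) (sym (walkVertices-sources (Path.walk path)))
        (rotate (∈-map⁺ proj₁ a∈))
      where
      rotate : proj₁ a ∈ₗ arcSources closedWalk →
               proj₁ a ∈ₗ arcSources (Path.walk path) ++ end ∷ []
      rotate (here refl) = ∈-++⁺ʳ (arcSources (Path.walk path)) (here refl)
      rotate (there q)   = ∈-++⁺ˡ q

  vertexDisjoint⇒arcDisjoint : ∀ C C′ → G.VertexDisjoint C C′ → G.ArcDisjoint C C′
  vertexDisjoint⇒arcDisjoint C C′ disjoint (a∈C , a∈C′) =
    disjoint (arc-source∈vertices C a∈C , arc-source∈vertices C′ a∈C′)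

  module _ (_≟ᵥ_ : DecidableEquality V) where
    open DecMembership _≟ᵥ_ using () renaming (_∈?_ to _∈ₗ?_)

    suffixFrom : ∀ {x y z} (w : Walk y z) → Unique (walkVertices w) →
                 x ∈ₗ walkVertices w → Path x z
    suffixFrom ε       u       (here refl) = record { walk = ε ; distinct = u }
    suffixFrom (a ◅ w) u       (here refl) = record { walk = a ◅ w ; distinct = u }
    suffixFrom (a ◅ w) (_ ∷ u) (there x∈)  = suffixFrom w u x∈

    -- Loop erasure: when the new first vertex recurs on the path built so far, only the part from
    -- that occurrence on is kept.
    walk⇒path : ∀ {x y} → Walk x y → Path x y
    walk⇒path ε = record { walk = ε ; distinct = All.[] ∷ [] }
    walk⇒path {x} (a ◅ w) with p ← walk⇒path w with x ∈ₗ? walkVertices (Path.walk p)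
    ... | yes x∈ = suffixFrom (Path.walk p) (Path.distinct p) x∈
    ... | no  x∉ = record { walk = a ◅ Path.walk p ; distinct = ¬Any⇒All¬ _ x∉ ∷ Path.distinct p }

-- Pigeonhole for subsets of a finite set.

injection-into-subset : ∀ {k n} (S : Subset n) (f : Fin k → Fin n) → Injective _≡_ _≡_ f →
                        (∀ t → f t ∈ S) → k ≤ ∣ S ∣
injection-into-subset {zero}  S f inj f∈S = z≤n
injection-into-subset {suc k} S f inj f∈S = ≤-<-trans
  (injection-into-subset (S - f zero) (f ∘ suc) (suc-injective ∘ inj)
    (λ t → x∈p∧x≢y⇒x∈p-y (f∈S (suc t)) (λ eq → contradiction (inj eq) λ ())))
  (x∈p⇒∣p-x∣<∣p∣ (f∈S zero))

injection-avoids-subset : ∀ {k n} (S : Subset n) (f : Fin k → Fin n) → Injective _≡_ _≡_ f →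
                          ∣ S ∣ < k → ∃[ t ] f t ∉ S
injection-avoids-subset S f inj ∣S∣<k = ¬∀⟶∃¬ _ _ (λ t → f t ∈? S)
  (λ f∈S → <⇒≱ ∣S∣<k (injection-into-subset S f inj f∈S))

-- Uniqueness of binary expansions.

binary : ∀ {n} → Vector ℕ n → ℕ
binary {zero}  c = 0
binary {suc n} c = c zero + 2 * binary (c ∘ suc)

binary-updateAt : ∀ {n} (c : Vector ℕ n) i → binary (updateAt c i suc) ≡ 2 ^ toℕ i + binary c
binary-updateAt {suc n} c zero    = refl
binary-updateAt {suc n} c (suc i) = begin
  c zero + 2 * binary (updateAt (c ∘ suc) i suc)
    ≡⟨ cong (λ b → c zero + 2 * b) (binary-updateAt (c ∘ suc) i) ⟩
  c zero + 2 * (2 ^ toℕ i + binary (c ∘ suc))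
    ≡⟨ solve 3 (λ d p b → d :+ con 2 :* (p :+ b) := con 2 :* p :+ (d :+ con 2 :* b))
         refl (c zero) (2 ^ toℕ i) (binary (c ∘ suc)) ⟩
  2 * 2 ^ toℕ i + (c zero + 2 * binary (c ∘ suc))  ∎
  where
  open ≡-Reasoning
  open +-*-Solver

digit-injective : ∀ {d d′} q q′ → d ≤ 1 → d′ ≤ 1 → d + 2 * q ≡ d′ + 2 * q′ → d ≡ d′ × q ≡ q′
digit-injective q q′ z≤n       z≤n       eq = refl , *-cancelˡ-≡ q q′ 2 eq
digit-injective q q′ z≤n       (s≤s z≤n) eq = contradiction eq (even≢odd q q′)
digit-injective q q′ (s≤s z≤n) z≤n       eq = contradiction (sym eq) (even≢odd q′ q)
digit-injective q q′ (s≤s z≤n) (s≤s z≤n) eq = refl , *-cancelˡ-≡ q q′ 2 (cong pred eq)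

-- Only the residue modulo `2 ^ n` matters, so `a` and `a′` may differ: as `a * 2 ^ suc n` is even,
-- the lowest digit is the parity of the sum, and halving leaves an equation of the same form.
binary-injective : ∀ {n} (c c′ : Vector ℕ n) a a′ → (∀ i → c i ≤ 1) → (∀ i → c′ i ≤ 1) →
                   a * 2 ^ n + binary c ≡ a′ * 2 ^ n + binary c′ → c ≗ c′
binary-injective {suc n} c c′ a a′ c≤1 c′≤1 eq = λ where
    zero    → proj₁ heads
    (suc i) → binary-injective (c ∘ suc) (c′ ∘ suc) a a′ (c≤1 ∘ suc) (c′≤1 ∘ suc) (proj₂ heads) i
  where
  open +-*-Solver
  horner : ∀ a d b → a * 2 ^ suc n + (d + 2 * b) ≡ d + 2 * (a * 2 ^ n + b)
  horner a d b = solve 4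
    (λ a p d b → a :* (con 2 :* p) :+ (d :+ con 2 :* b) := d :+ con 2 :* (a :* p :+ b))
    refl a (2 ^ n) d b
  heads = digit-injective (a * 2 ^ n + binary (c ∘ suc)) (a′ * 2 ^ n + binary (c′ ∘ suc))
    (c≤1 zero) (c′≤1 zero)
    (trans (sym (horner a (c zero) (binary (c ∘ suc))))
      (trans eq (horner a′ (c′ zero) (binary (c′ ∘ suc)))))

-- Layered digraphs with back arcs, and the lengths of their cycles.

module Layered {V : Set} (layer : V → ℕ) {N : ℕ} (src tgt : Fin N → V)
  (drop : ∀ i → layer (tgt i) + (2 ^ N + 2 ^ toℕ i) ≡ suc (layer (src i))) where

  data Arc : Rel V 0ℓ where
    up   : ∀ {x y} → layer y ≡ suc (layer x) → Arc x y
    back : ∀ i → Arc (src i) (tgt i)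

  private module G = Directed Arc
  open G using (Walk; walkArcs)

  Arc-irreflexive : Irreflexive _≡_ Arc
  Arc-irreflexive refl a = irrefl a refl
    where
    irrefl : ∀ {x y} → Arc x y → x ≢ y
    irrefl (up eq)  refl = 1+n≢n (sym eq)
    irrefl (back i) eq   = contradiction
      -- A back arc that is a loop would give `2 ^ N + 2 ^ toℕ i ≡ 1`, but both powers are positive.
      (+-cancelˡ-≡ (layer (src i)) _ 1 (trans (cong (λ v → layer v + (2 ^ N + 2 ^ toℕ i)) eq)
        (trans (drop i) (+-comm 1 (layer (src i))))))
      (>⇒≢ (+-mono-≤ (m^n>0 2 N) (m^n>0 2 (toℕ i))))

  Arc? : DecidableEquality V → Decidable Arc
  Arc? _≟ᵥ_ x y = map′
    (λ { (inj₁ eq) → up eq ; (inj₂ (i , refl , refl)) → back i })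
    (λ { (up eq) → inj₁ eq ; (back i) → inj₂ (i , refl , refl) })
    (layer y ≟ℕ suc (layer x)
      ⊎-dec any? (λ i → src i ≟ᵥ x ×-dec tgt i ≟ᵥ y))

  backCount : ∀ {x y} → Walk x y → Vector ℕ N
  backCount ε            = λ _ → 0
  backCount (up _   ◅ w) = backCount w
  backCount (back i ◅ w) = updateAt (backCount w) i suc

  backCount≢0⇒∈ : ∀ {x y} (w : Walk x y) i → backCount w i ≢ 0 → (src i , tgt i) ∈ₗ walkArcs w
  backCount≢0⇒∈ ε            i c≢0 = contradiction refl c≢0
  backCount≢0⇒∈ (up _   ◅ w) i c≢0 = there (backCount≢0⇒∈ w i c≢0)
  backCount≢0⇒∈ (back j ◅ w) i c≢0 with i ≟ j
  ... | yes refl = here refl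
  ... | no  i≢j  = there (backCount≢0⇒∈ w i (c≢0 ∘ trans (updateAt-minimal i j (backCount w) i≢j)))

  -- Using a back arc twice would repeat its source.
  backCount≤1 : ∀ {x y} (w : Walk x y) → Unique (arcSources w) → ∀ i → backCount w i ≤ 1
  backCount≤1 ε            u         i = z≤n
  backCount≤1 (up _   ◅ w) (_ ∷ u)   i = backCount≤1 w u i
  backCount≤1 (back j ◅ w) (new ∷ u) i with i ≟ j
  ... | no i≢j = ≤-trans (≤-reflexive (updateAt-minimal i j (backCount w) i≢j)) (backCount≤1 w u i)
  ... | yes refl with backCount w i ≟ℕ 0
  ...   | yes c≡0 = ≤-reflexive (trans (updateAt-updates i (backCount w)) (cong suc c≡0))
  ...   | no  c≢0 = contradiction refl (All.lookup new (∈-map⁺ proj₁ (backCount≢0⇒∈ w i c≢0)))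

  -- Here a is the number of back arcs of w.
  balance : ∀ {x y} (w : Walk x y) →
            ∃[ a ] layer y + (a * 2 ^ N + binary (backCount w)) ≡ layer x + length (walkArcs w)
  balance {x} ε = 0 , cong (layer x +_) (binary-zero N)
    where
    binary-zero : ∀ n → binary {n} (λ _ → 0) ≡ 0
    binary-zero zero    = refl
    binary-zero (suc n) = cong (2 *_) (binary-zero n)
  balance {x} (up eq ◅ w) with a , ih ← balance w =
    a , trans ih (trans (cong (_+ length (walkArcs w)) eq) (sym (+-suc (layer x) _)))
  balance {y = y} (back i ◅ w) with a , ih ← balance w = suc a , (begin
    layer y + (suc a * 2 ^ N + binary (updateAt (backCount w) i suc))
      ≡⟨ cong (λ b → layer y + (suc a * 2 ^ N + b)) (binary-updateAt (backCount w) i) ⟩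
    layer y + (suc a * 2 ^ N + (2 ^ toℕ i + binary (backCount w)))
      ≡⟨ solve 5 (λ l a p q b →
             l :+ ((con 1 :+ a) :* p :+ (q :+ b)) := (l :+ (a :* p :+ b)) :+ (p :+ q))
           refl (layer y) a (2 ^ N) (2 ^ toℕ i) (binary (backCount w)) ⟩
    layer y + (a * 2 ^ N + binary (backCount w)) + (2 ^ N + 2 ^ toℕ i)
      ≡⟨ cong (_+ (2 ^ N + 2 ^ toℕ i)) ih ⟩
    layer (tgt i) + len + (2 ^ N + 2 ^ toℕ i)
      ≡⟨ solve 3 (λ l n p → l :+ n :+ p := l :+ p :+ n)
           refl (layer (tgt i)) len (2 ^ N + 2 ^ toℕ i) ⟩
    layer (tgt i) + (2 ^ N + 2 ^ toℕ i) + len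
      ≡⟨ cong (_+ len) (drop i) ⟩
    suc (layer (src i)) + len
      ≡⟨ sym (+-suc (layer (src i)) len) ⟩
    layer (src i) + suc len ∎)
    where
    open ≡-Reasoning
    open +-*-Solver
    len = length (walkArcs w)

  -- Up arcs gain exactly one layer each, so a closed walk with at least one arc must use a back
  -- arc.
  backFree-climbs : ∀ {x y} (w : Walk x y) → (∀ i → backCount w i ≡ 0) →
                    layer y ≡ layer x + length (walkArcs w)
  backFree-climbs ε            c≡0 = sym (+-identityʳ _)
  backFree-climbs (up eq ◅ w)  c≡0 =
    trans (backFree-climbs w c≡0) (trans (cong (_+ length (walkArcs w)) eq) (sym (+-suc _ _)))
  backFree-climbs (back i ◅ w) c≡0 =
    contradiction (trans (sym (updateAt-updates i (backCount w))) (c≡0 i)) 1+n≢0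

  closedWalk-length : ∀ {x} (w : Walk x x) →
                      ∃[ a ] a * 2 ^ N + binary (backCount w) ≡ length (walkArcs w)
  closedWalk-length {x} w with a , eq ← balance w = a , +-cancelˡ-≡ (layer x) _ _ eq

  equalLength⇒¬arcDisjoint : ∀ C C′ → G.cycleLength C ≡ G.cycleLength C′ → ¬ G.ArcDisjoint C C′
  equalLength⇒¬arcDisjoint C C′ len≡ disjoint =
    -- Without back arcs the closed walk would end at least one layer above its own start.
    m+1+n≢m (layer (G.Cycle.end C)) (sym (backFree-climbs (closedWalk C) unused))
    where
    len  = closedWalk-length (closedWalk C)
    len′ = closedWalk-length (closedWalk C′)
    same : backCount (closedWalk C) ≗ backCount (closedWalk C′)
    same = binary-injective _ _ (proj₁ len) (proj₁ len′)
      (backCount≤1 (closedWalk C) (closedWalk-sources-unique C))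
      (backCount≤1 (closedWalk C′) (closedWalk-sources-unique C′))
      (trans (proj₂ len) (trans len≡ (sym (proj₂ len′))))
    -- The counts agree, so a back arc used by `C` is also used by `C′`, against disjointness.
    unused : ∀ i → backCount (closedWalk C) i ≡ 0
    unused i with backCount (closedWalk C) i ≟ℕ 0
    ... | yes c≡0 = c≡0
    ... | no  c≢0 = contradiction
      (backCount≢0⇒∈ (closedWalk C) i c≢0 ,
       backCount≢0⇒∈ (closedWalk C′) i (c≢0 ∘ trans (same i)))
      (λ shared → disjoint shared)

-- The digraph for a given k.

module Construction (k : ℕ) where

  -- There are k * k back arcs at the top layer and k * k at the bottom one. Since i < N, each
  -- segment of `2 ^ N + 2 ^ i` layers fits into `2 ^ suc N` layers.
  N halfHeight height : ℕ
  N = k * k + k * k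
  halfHeight = 2 ^ N
  height = 2 ^ suc N

  instance
    height≢0 : NonZero height
    height≢0 = m^n≢0 2 (suc N)

  -- inj₁ (r , t): the t-th arc out of the r-th top vertex;
  -- inj₂ (t , r): the t-th arc into the r-th bottom vertex.
  BackIndex : Set
  BackIndex = (Fin k × Fin k) ⊎ (Fin k × Fin k)

  backIndex : Fin N ↔ BackIndex
  backIndex = (*↔× ⊎-↔ *↔×) ↔-∘ +↔⊎

  open Inverse backIndex using (to; from; strictlyInverseˡ)

  V : Set
  V = Fin (height * k)

  vertex : ∀ l → l < height → Fin k → V
  vertex l l<h c = combine (fromℕ< l<h) c

  layer : V → ℕ
  layer x = toℕ (quotient {height} k x)

  layer-vertex : ∀ l (l<h : l < height) c → layer (vertex l l<h c) ≡ l
  layer-vertex l l<h c =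
    trans (cong (toℕ ∘ proj₁) (remQuot-combine (fromℕ< l<h) c))
      (toℕ-fromℕ< l<h)

  layer<height : ∀ x → layer x < height
  layer<height x = toℕ<n (quotient {height} k x)

  layer⇒vertex : ∀ {l} (l<h : l < height) x → layer x ≡ l → ∃[ c ] vertex l l<h c ≡ x
  layer⇒vertex l<h x eq = remainder {height} k x , trans
    (cong (λ q → combine q (remainder {height} k x))
      (toℕ-injective (trans (toℕ-fromℕ< l<h) (sym eq))))
    (combine-remQuot {height} k x)

  vertex-injective : ∀ l (l<h : l < height) → Injective _≡_ _≡_ (vertex l l<h)
  vertex-injective l l<h {c} {d} = combine-injectiveʳ (fromℕ< l<h) c (fromℕ< l<h) d

  top : ℕ
  top = pred height

  top<height : top < height
  top<height = ≤-reflexive (suc-pred height)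

  2^i<halfHeight : ∀ (i : Fin N) → 2 ^ toℕ i < halfHeight
  2^i<halfHeight i = ^-monoʳ-< 2 (s<s z<s) (toℕ<n i)

  suc-pred-2^ : ∀ n → suc (pred (2 ^ n)) ≡ 2 ^ n
  suc-pred-2^ n = suc-pred (2 ^ n) {{m^n≢0 2 n}}

  -- The layers forced by the segment length: `below i` is the lowest layer of a segment that ends
  -- at the top, `above i` the highest layer of one that starts at layer 0.
  below above : Fin N → ℕ
  below i = halfHeight ∸ 2 ^ toℕ i
  above i = halfHeight + pred (2 ^ toℕ i)

  below<halfHeight : ∀ i → below i < halfHeight
  below<halfHeight i = ∸-monoʳ-< (m^n>0 2 (toℕ i)) (<⇒≤ (2^i<halfHeight i))

  below<height : ∀ i → below i < height
  below<height i = <-≤-trans (below<halfHeight i) (m≤m+n halfHeight _)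

  above<height : ∀ i → above i < height
  above<height i = +-monoʳ-< halfHeight
    -- `height` unfolds to `halfHeight + (halfHeight + 0)`, whence the bound with 0.
    (≤-<-trans pred[n]≤n (<-≤-trans (2^i<halfHeight i) (m≤m+n halfHeight 0)))

  -- The free end of a back arc lies in column t, so the k arcs at one vertex have distinct free
  -- ends whatever their layers. Keeping i apart from its decoding lets `backArc` replace
  -- `to (from p)` by `p` without touching the exponent.
  source target : Fin N → BackIndex → V
  source i (inj₁ (r , _)) = vertex top top<height r
  source i (inj₂ (t , _)) = vertex (above i) (above<height i) t
  target i (inj₁ (_ , t)) = vertex (below i) (below<height i) t
  target i (inj₂ (_ , r)) = vertex 0 (m^n>0 2 (suc N)) r

  drop : ∀ i p → layer (target i p) + (2 ^ N + 2 ^ toℕ i) ≡ suc (layer (source i p))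
  drop i (inj₁ (r , t))
    rewrite layer-vertex (below i) (below<height i) t | layer-vertex top top<height r = begin
    below i + (halfHeight + 2 ^ toℕ i)   ≡⟨ cong (below i +_) (+-comm halfHeight _) ⟩
    below i + (2 ^ toℕ i + halfHeight)   ≡⟨ sym (+-assoc (below i) _ _) ⟩
    below i + 2 ^ toℕ i + halfHeight     ≡⟨ cong (_+ halfHeight) (m∸n+n≡m (<⇒≤ (2^i<halfHeight i))) ⟩
    halfHeight + halfHeight              ≡⟨ cong (halfHeight +_) (sym (+-identityʳ halfHeight)) ⟩
    height                               ≡⟨ sym (suc-pred height) ⟩
    suc top                              ∎
    where open ≡-Reasoning
  drop i (inj₂ (t , r))
    rewrite layer-vertex 0 (m^n>0 2 (suc N)) r | layer-vertex (above i) (above<height i) t =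
    trans (cong (halfHeight +_) (sym (suc-pred-2^ (toℕ i)))) (+-suc halfHeight _)

  open Layered layer (λ i → source i (to i)) (λ i → target i (to i)) (λ i → drop i (to i)) public

  backArc : ∀ p → Arc (source (from p) p) (target (from p) p)
  backArc p = subst (λ q → Arc (source (from p) q) (target (from p) q))
    (strictlyInverseˡ p) (back (from p))

  digraph : Digraph
  digraph = record
    { order = height * k ; _⟶_ = Arc ; _⟶?_ = Arc? _≟_ ; noLoop = Arc-irreflexive }

  -- Strong connectivity after deleting fewer than k vertices.

  module Survivors (S : Subset (height * k)) (∣S∣<k : ∣ S ∣ < k) where

    Remaining : Set
    Remaining = [ v ∈ V ∣ v ∉ S ]

    open Directed (Deleted digraph S) using (Walk; StronglyConnected)

    level : Remaining → ℕ
    level = layer ∘ value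

    survivor : ∀ {l} → l < height → ∃[ z ] level z ≡ l
    survivor {l} l<h
      with c , c∉S ← injection-avoids-subset S (vertex l l<h) (vertex-injective l l<h) ∣S∣<k =
      (vertex l l<h c , [ c∉S ]) , layer-vertex l l<h c

    -- Here d counts the layers strictly between x and y. Consecutive layers are completely joined,
    -- so any survivor of each will do.
    climb : ∀ d {x y} → suc (level x) + d ≡ level y → Walk x y
    climb zero    eq = up (trans (sym eq) (+-identityʳ _)) ◅ ε
    climb (suc d) {x} {y} eq
      with z , lz ← survivor
        (≤-<-trans (m+n≤o⇒m≤o (suc (level x)) (≤-reflexive eq)) (layer<height (value y))) =
      up lz ◅ climb d {z} {y}
        (trans (cong (λ l → suc l + d) lz) (trans (sym (+-suc (suc (level x)) d)) eq))

    ascend : ∀ {x y} → level x < level y → Walk x y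
    ascend x<y with d , eq ← m≤n⇒∃[o]m+o≡n x<y = climb d eq

    toTop : ∀ x → ∃[ u ] level u ≡ top × Walk x u
    toTop x with m≤n⇒m<n∨m≡n (pred-mono-≤ (layer<height (value x)))
    ... | inj₂ x≡top = x , x≡top , ε
    ... | inj₁ x<top with u , lu ← survivor top<height =
      u , lu , ascend (<-≤-trans x<top (≤-reflexive (sym lu)))

    fromBottom : ∀ y → ∃[ v ] level v ≡ 0 × Walk v y
    fromBottom y with m≤n⇒m<n∨m≡n {0} {level y} z≤n
    ... | inj₂ 0≡y = y , sym 0≡y , ε
    ... | inj₁ 0<y with v , lv ← survivor (m^n>0 2 (suc N)) =
      v , lv , ascend (≤-<-trans (≤-reflexive lv) 0<y)

    leaveTop : ∀ u → level u ≡ top → ∃[ z ] level z < halfHeight × Walk u z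
    leaveTop u lu with r , eq ← layer⇒vertex top<height (value u) lu
      with t , t∉S ← injection-avoids-subset S (λ t → target (from (inj₁ (r , t))) (inj₁ (r , t)))
        -- The targets may lie in different layers; their columns t already tell them apart.
        (λ {t} {t′} → combine-injectiveʳ {height} _ t _ t′) ∣S∣<k =
      let i = from (inj₁ (r , t)) in
      (target i (inj₁ (r , t)) , [ t∉S ])
      , ≤-<-trans (≤-reflexive (layer-vertex (below i) (below<height i) t)) (below<halfHeight i)
      , subst (λ x → Arc x (target i (inj₁ (r , t)))) eq (backArc (inj₁ (r , t))) ◅ ε

    enterBottom : ∀ v → level v ≡ 0 → ∃[ z ] halfHeight ≤ level z × Walk z v
    enterBottom v lv with r , eq ← layer⇒vertex (m^n>0 2 (suc N)) (value v) lv
      with t , t∉S ← injection-avoids-subset S (λ t → source (from (inj₂ (t , r))) (inj₂ (t , r)))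
        (λ {t} {t′} → combine-injectiveʳ {height} _ t _ t′) ∣S∣<k =
      let i = from (inj₂ (t , r)) in
      (source i (inj₂ (t , r)) , [ t∉S ])
      , ≤-trans (m≤m+n halfHeight _) (≤-reflexive (sym (layer-vertex (above i) (above<height i) t)))
      , subst (Arc (source i (inj₂ (t , r)))) eq (backArc (inj₂ (t , r))) ◅ ε

    stronglyConnected : StronglyConnected
    stronglyConnected x y
      with u  , u-top    , x⟶u  ← toTop x
      with v  , v-bottom , v⟶y  ← fromBottom y
      with z  , z-low    , u⟶z  ← leaveTop u u-top
      with z′ , z′-high  , z′⟶v ← enterBottom v v-bottom =
      walk⇒path (Refinement._≟_ _≟_)
        -- The middle climb exists because `halfHeight` separates the levels of z and z′.
        (x⟶u ◅◅ u⟶z ◅◅ ascend (<-≤-trans z-low z′-high) ◅◅ z′⟶v ◅◅ v⟶y)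

  stronglyKConnected : 1 ≤ k → StronglyKConnected digraph k
  stronglyKConnected 1≤k =
    (begin
      k + 1       ≤⟨ +-monoʳ-≤ k 1≤k ⟩
      k + k       ≡⟨ cong (k +_) (sym (+-identityʳ k)) ⟩
      -- `height` is `2 * 2 ^ N`, hence at least 2.
      2 * k       ≤⟨ *-monoˡ-≤ k (*-monoʳ-≤ 2 (m^n>0 2 N)) ⟩
      height * k  ∎)
    , Survivors.stronglyConnected
    where open ≤-Reasoning

proposition4 : ∀ (k : ℕ) → 1 ≤ k →
    Σ[ D ∈ Digraph ] (StronglyKConnected D k
    × (∀ (C C′ : Cycle D) → cycleLength D C ≡ cycleLength D C′ → ¬ ArcDisjoint D C C′)
    × (∀ (C C′ : Cycle D) → cycleLength D C ≡ cycleLength D C′ → ¬ VertexDisjoint D C C′))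
proposition4 k 1≤k =
  digraph , stronglyKConnected 1≤k , equalLength⇒¬arcDisjoint ,
  λ C C′ len≡ disjoint →
    equalLength⇒¬arcDisjoint C C′ len≡ (vertexDisjoint⇒arcDisjoint C C′ disjoint)
  where
  open Construction k
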